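{- (i) For hypercubes, $k_{\min}(Q_t)=t=\mathrm{diam}(Q_t)=\log_2|V(Q_t)|$. (ii) For complete graphs of order $2^t$ (diameter $1$, $t\ge1$), $k_{\min}(K_{2^t})=t$, realized by $K_{2^t}=\mathrm{Cay}(\mathbb{Z}_2^t,\mathbb{Z}_2^t\setminus\{\mathbf{0}\})$. (iii) For even cycles ($d\ge 2$), $k_{\min}(C_{2d})=d=\mathrm{diam}(C_{2d})$, realized by the quotient labeling of the partition of $E(C_{2d})$ into antipodal pairs of edges, for which the number of classes is $t=d$, the rank of the cycle–class parity matrix is $\rho=0$, and the dimension is $k=t-\rho=d$.
   Context: Graphs are finite, simple, connected and undirected; $\mathrm{diam}$ is the diameter in the shortest-path metric. For a generating set $S\subseteq\mathbb{Z}_2^k\setminus\{0\}$, $\mathrm{Cay}(\mathbb{Z}_2^k,S)$ is the graph on $\mathbb{Z}_2^k$ with edges $\{g,g+s\}$, $s\in S$. $k_{\min}(G)$ is the least $k$ such that $G$ embeds isometrically (distance-preservingly) into $\mathrm{Cay}(\mathbb{Z}_2^k,S)$ for some such $S$. $Q_t=\mathrm{Cay}(\mathbb{Z}_2^t,\{e_1,\dots,e_t\})$ is the hypercube. In $C_{2d}$ with vertices $v_0,\dots,v_{2d-1}$ (indices mod $2d$), antipodal pairs of edges are $\{v_av_{a+1},v_{a+d}v_{a+d+1}\}$. For a partition $F_1,\dots,F_t$ of $E(G)$ and a cycle basis $B_1,\dots,B_c$ of $G$ over $\mathbb{F}_2$, the cycle–class parity matrix is $A[i,j]=|F_j\cap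 E(B_i)|\bmod 2$ with rank $\rho$ over $\mathbb{F}_2$; the quotient labeling assigns to class $j$ the image $g_j$ of the $j$-th standard basis vector in $\mathbb{Z}_2^t/\mathrm{rowspan}(A)\cong\mathbb{Z}_2^{t-\rho}$ and labels each vertex $v$ by the sum of the $g_j$ of the edges on a path from a fixed root to $v$, with $S=\{g_j:g_j\ne\mathbf 0\}$. -}

module Defs where

open import Algebra.Bundles using (AbelianGroup)
open import Algebra.Morphism.Structures using (IsGroupHomomorphism)
import Algebra.Properties.CommutativeMonoid.Sum as Sum
open import Data.Empty using (⊥; ⊥-elim)
open import Data.Fin.Base using (Fin; zero; suc; toℕ)
import Data.Fin.Properties as Fin
open import Data.Fin.Subset using (Subset; Side; inside; outside; _∈_; _∩_; _∪_; ⁅_⁆; ∣_∣; Nonempty)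
open import Data.Nat.Base using (ℕ; zero; suc; _+_; _*_; _∸_; _^_; _≤_; _<_; NonZero; z≤n; s≤s; parity)
open import Data.Nat.DivMod using (_mod_; _%_; _/_; %-distribˡ-+; m%n%n≡m%n; m<n⇒m%n≡m; [m+n]%n≡m%n; m≡m%n+[m/n]*n)
import Data.Nat.Properties as ℕ
open import Data.Parity.Base as ℙ using (Parity; 0ℙ; 1ℙ)
import Data.Parity.Properties as ℙ
open import Data.Product.Base using (Σ; ∃-syntax; _×_; _,_; proj₁; proj₂)
open import Data.Product using (∃!)
open import Data.Product.Function.NonDependent.Propositional using (_×-↔_)
open import Data.Sum.Base using (_⊎_; inj₁; inj₂; swap)
open import Data.Vec.Base as Vec using (Vec; []; _∷_; replicate; zipWith; tabulate)
import Data.Vec.Properties as Vec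
open import Function.Base using (id; _∘_)
open import Function.Bundles using (_↔_; _⇔_; mk↔ₛ′; Inverse)
open import Function.Construct.Composition using (_↔-∘_)
open import Function.Construct.Identity using (↔-id)
open import Function.Construct.Symmetry using (↔-sym)
open import Function.Definitions using (Injective; StrictlySurjective)
open import Level using (0ℓ)
open import Relation.Binary.Core using (Rel)
open import Relation.Binary.Definitions using (Symmetric; Irreflexive; Decidable; DecidableEquality)
open import Relation.Binary.PropositionalEquality
open import Relation.Nullary using (¬_; yes; no; ¬?)
open import Relation.Nullary.Decidable using (map′; _×-dec_; _⊎-dec_)
import Relation.Unary as U

Z₂^_ : ℕ → Set
Z₂^ k = Vec Parity k

infixl 6 _⊕_
_⊕_ : ∀ {k} → Z₂^ k → Z₂^ k → Z₂^ k
_⊕_ = zipWith ℙ._+_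

𝟎 : ∀ {k} → Z₂^ k
𝟎 {k} = replicate k 0ℙ

infixl 7 _·_
_·_ : ∀ {k} → Parity → Z₂^ k → Z₂^ k
c · x = Vec.map (c ℙ.*_) x

_≟ᶻ_ : ∀ {k} → DecidableEquality (Z₂^ k)
_≟ᶻ_ = Vec.≡-dec ℙ._≟_

⊕-identityˡ : ∀ {k} (x : Z₂^ k) → 𝟎 ⊕ x ≡ x
⊕-identityˡ = Vec.zipWith-identityˡ ℙ.+-identityˡ

⊕-identityʳ : ∀ {k} (x : Z₂^ k) → x ⊕ 𝟎 ≡ x
⊕-identityʳ = Vec.zipWith-identityʳ ℙ.+-identityʳ

⊕-assoc : ∀ {k} (x y z : Z₂^ k) → (x ⊕ y) ⊕ z ≡ x ⊕ (y ⊕ z)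
⊕-assoc = Vec.zipWith-assoc ℙ.+-assoc

⊕-comm : ∀ {k} (x y : Z₂^ k) → x ⊕ y ≡ y ⊕ x
⊕-comm = Vec.zipWith-comm ℙ.+-comm

⊕-self : ∀ {k} (x : Z₂^ k) → x ⊕ x ≡ 𝟎
⊕-self []      = refl
⊕-self (p ∷ x) = cong₂ _∷_ (ℙ.p+p≡0ℙ p) (⊕-self x)

⊕-cancel : ∀ {k} (x y : Z₂^ k) → x ⊕ (x ⊕ y) ≡ y
⊕-cancel x y = trans (sym (⊕-assoc x x y)) (trans (cong (_⊕ y) (⊕-self x)) (⊕-identityˡ y))

⊕-cancelʳ : ∀ {k} (x y : Z₂^ k) → (x ⊕ y) ⊕ y ≡ x
⊕-cancelʳ x y = trans (⊕-assoc x y y) (trans (cong (x ⊕_) (⊕-self y)) (⊕-identityʳ x))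

Z₂^-abelianGroup : ℕ → AbelianGroup 0ℓ 0ℓ
Z₂^-abelianGroup k = record
  { Carrier = Z₂^ k
  ; _≈_     = _≡_
  ; _∙_     = _⊕_
  ; ε       = 𝟎
  ; _⁻¹     = id
  ; isAbelianGroup = record
    { isGroup = record
      { isMonoid = record
        { isSemigroup = record
          { isMagma = record { isEquivalence = isEquivalence ; ∙-cong = cong₂ _⊕_ }
          ; assoc   = ⊕-assoc
          }
        ; identity = ⊕-identityˡ , ⊕-identityʳ
        }
      ; inverse = ⊕-self , ⊕-self
      ; ⁻¹-cong = id
      }
    ; comm = ⊕-comm
    }
  }

𝐞 : ∀ {k} → Fin k → Z₂^ k
𝐞 zero    = 1ℙ ∷ 𝟎
𝐞 (suc i) = 0ℙ ∷ 𝐞 i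

⨁ : ∀ {k c} → (Fin c → Z₂^ k) → Z₂^ k
⨁ {k} = Sum.sum (AbelianGroup.commutativeMonoid (Z₂^-abelianGroup k))

lincomb : ∀ {k c} → (Fin c → Parity) → (Fin c → Z₂^ k) → Z₂^ k
lincomb a v = ⨁ λ i → a i · v i

LinearlyIndependent : ∀ {k c} → (Fin c → Z₂^ k) → Set
LinearlyIndependent v = ∀ a → lincomb a v ≡ 𝟎 → ∀ i → a i ≡ 0ℙ

_∈span_ : ∀ {k c} → Z₂^ k → (Fin c → Z₂^ k) → Set
x ∈span v = ∃[ a ] lincomb a v ≡ x

-- A matrix over 𝔽₂ with c rows and t columns is the family of its rows.
Matrix : ℕ → ℕ → Set
Matrix c t = Fin c → Z₂^ t

-- The rank is the dimension of the row space.
HasRank : ∀ {c t} → Matrix c t → ℕ → Set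
HasRank {c} {t} A ρ = Σ (Fin ρ → Z₂^ t) λ b →
  LinearlyIndependent b × (∀ x → x ∈span b ⇔ x ∈span A)

data Walk {V : Set} (_~_ : Rel V 0ℓ) : V → V → ℕ → Set where
  []  : ∀ {u} → Walk _~_ u u 0
  _∷_ : ∀ {u v w n} → u ~ v → Walk _~_ v w n → Walk _~_ u w (suc n)

record Graph : Set₁ where
  field
    V         : Set
    order     : ℕ
    enumerate : V ↔ Fin order
    Adj       : Rel V 0ℓ
    Adj?      : Decidable Adj
    symmetric : Symmetric Adj
    loopless  : Irreflexive _≡_ Adj
    connected : ∀ u v → ∃[ n ] Walk Adj u v n

open Graph public

Distance : (G : Graph) → V G → V G → ℕ → Set
Distance G u v n = Walk (Adj G) u v n × (∀ {m} → Walk (Adj G) u v m → n ≤ m)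

HasDiameter : Graph → ℕ → Set
HasDiameter G d =
  (∀ u v → ∃[ n ] Distance G u v n × n ≤ d) × (∃[ u ] ∃[ v ] Distance G u v d)

IsIsometric : (G H : Graph) → (V G → V H) → Set
IsIsometric G H f = ∀ u v n → Distance G u v n ⇔ Distance H (f u) (f v) n

record _≅_ (G H : Graph) : Set where
  field
    bijection : V G ↔ V H
  open Inverse bijection public using (to; from)
  field
    preserves : ∀ u v → Adj G u v ⇔ Adj H (to u) (to v)

-- The subgroup generated by S; since every element is its own inverse, no
-- closure under inverses is needed.
data ⟨_⟩ {k} (S : U.Pred (Z₂^ k) 0ℓ) : Z₂^ k → Set where
  ε   : ⟨ S ⟩ 𝟎
  _∷_ : ∀ {s g} → S s → ⟨ S ⟩ g → ⟨ S ⟩ (s ⊕ g)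

record GeneratingSet (k : ℕ) : Set₁ where
  field
    S         : U.Pred (Z₂^ k) 0ℓ
    S?        : U.Decidable S
    nonzero   : ¬ S 𝟎
    generates : ∀ g → ⟨ S ⟩ g

Parity↔Fin2 : Parity ↔ Fin 2
Parity↔Fin2 = mk↔ₛ′
  (λ { 0ℙ → zero ; 1ℙ → suc zero })
  (λ { zero → 0ℙ ; (suc zero) → 1ℙ })
  (λ { zero → refl ; (suc zero) → refl })
  (λ { 0ℙ → refl ; 1ℙ → refl })

Z₂^↔Fin : ∀ k → Z₂^ k ↔ Fin (2 ^ k)
Z₂^↔Fin zero    = mk↔ₛ′ (λ _ → zero) (λ _ → []) (λ { zero → refl }) (λ { [] → refl })
Z₂^↔Fin (suc k) = ↔-sym Fin.*↔× ↔-∘ ((Parity↔Fin2 ×-↔ Z₂^↔Fin k) ↔-∘ uncons↔)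
  where
  uncons↔ : Z₂^ (suc k) ↔ (Parity × Z₂^ k)
  uncons↔ = mk↔ₛ′ Vec.uncons (λ (p , x) → p ∷ x) (λ _ → refl) (λ { (_ ∷ _) → refl })

module _ {k} (𝓢 : GeneratingSet k) where
  open GeneratingSet 𝓢

  CayAdj : Rel (Z₂^ k) 0ℓ
  CayAdj g h = ∃[ s ] S s × h ≡ g ⊕ s

  private
    walk : ∀ x {g} → ⟨ S ⟩ g → ∃[ n ] Walk CayAdj x (x ⊕ g) n
    walk x ε = 0 , subst (λ y → Walk CayAdj x y 0) (sym (⊕-identityʳ x)) []
    walk x (_∷_ {s} {g} s∈S g∈) with walk (x ⊕ s) g∈
    ... | n , w = suc n ,
      ((s , s∈S , refl) ∷ subst (λ y → Walk CayAdj (x ⊕ s) y n) (⊕-assoc x s g) w)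

  Cay : Graph
  Cay = record
    { V         = Z₂^ k
    ; order     = 2 ^ k
    ; enumerate = Z₂^↔Fin k
    ; Adj       = CayAdj
    ; Adj?      = λ g h → map′
        (λ p → g ⊕ h , p , sym (⊕-cancel g h))
        (λ { (s , p , refl) → subst S (sym (⊕-cancel g s)) p })
        (S? (g ⊕ h))
    ; symmetric = λ { {g} (s , p , refl) → s , p , sym (⊕-cancelʳ g s) }
    ; loopless  = λ { {g} refl (s , p , eq) →
        nonzero (subst S (trans (sym (⊕-cancel g s)) (trans (cong (g ⊕_) (sym eq)) (⊕-self g))) p) }
    ; connected = λ g h →
        let n , w = walk g (generates (g ⊕ h))
        in n , subst (λ y → Walk CayAdj g y n) (⊕-cancel g h) w
    }

EmbedsInDimension : Graph → ℕ → Set₁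
EmbedsInDimension G k =
  Σ (GeneratingSet k) λ 𝓢 → Σ (V G → Z₂^ k) λ f → IsIsometric G (Cay 𝓢) f

-- The relation kmin(G) = k; likewise Distance and HasDiameter are the graphs of
-- the corresponding functions.
IsKmin : Graph → ℕ → Set₁
IsKmin G k = EmbedsInDimension G k × (∀ j → EmbedsInDimension G j → k ≤ j)

IsUnit : ∀ {k} → U.Pred (Z₂^ k) 0ℓ
IsUnit x = ∃[ i ] 𝐞 i ≡ x

𝐞≢𝟎 : ∀ {k} (i : Fin k) → 𝐞 i ≢ 𝟎
𝐞≢𝟎 zero    ()
𝐞≢𝟎 (suc i) eq = 𝐞≢𝟎 i (Vec.∷-injectiveʳ eq)

private
  0∷_ : ∀ {k} {x : Z₂^ k} → ⟨ IsUnit ⟩ x → ⟨ IsUnit ⟩ (0ℙ ∷ x)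
  0∷ ε                 = ε
  0∷ ((i , refl) ∷ x∈) = (suc i , refl) ∷ (0∷ x∈)

units-generate : ∀ {k} (x : Z₂^ k) → ⟨ IsUnit ⟩ x
units-generate []       = ε
units-generate (0ℙ ∷ x) = 0∷ units-generate x
units-generate (1ℙ ∷ x) = subst (λ y → ⟨ IsUnit ⟩ (1ℙ ∷ y)) (⊕-identityˡ x)
  ((zero , refl) ∷ (0∷ units-generate x))

units : ∀ k → GeneratingSet k
units k = record
  { S         = IsUnit
  ; S?        = λ x → Fin.any? λ i → 𝐞 i ≟ᶻ x
  ; nonzero   = λ { (i , eq) → 𝐞≢𝟎 i eq }
  ; generates = units-generate
  }

Q : ℕ → Graph
Q t = Cay (units t)

K : ℕ → Graph
K n = record
  { V         = Fin n
  ; order     = n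
  ; enumerate = ↔-id (Fin n)
  ; Adj       = _≢_
  ; Adj?      = λ u v → ¬? (u Fin.≟ v)
  ; symmetric = ≢-sym
  ; loopless  = λ eq neq → neq eq
  ; connected = conn
  }
  where
  conn : ∀ u v → ∃[ m ] Walk _≢_ u v m
  conn u v with u Fin.≟ v
  ... | yes refl = 0 , []
  ... | no  u≢v  = 1 , (u≢v ∷ [])

allNonzero : ∀ k → GeneratingSet k
allNonzero k = record
  { S         = _≢ 𝟎
  ; S?        = λ x → ¬? (x ≟ᶻ 𝟎)
  ; nonzero   = λ 𝟎≢𝟎 → 𝟎≢𝟎 refl
  ; generates = gen
  }
  where
  gen : ∀ g → ⟨ _≢ 𝟎 ⟩ g
  gen g with g ≟ᶻ 𝟎
  ... | yes refl = ε
  ... | no  g≢𝟎  = subst ⟨ _≢ 𝟎 ⟩ (⊕-identityʳ g) (g≢𝟎 ∷ ε)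

infixl 6 _⊞_
_⊞_ : ∀ {n} → Fin n → ℕ → Fin n
_⊞_ {n} i a = _mod_ (toℕ i + a) n {{Fin.nonZeroIndex i}}

toℕ-⊞ : ∀ {n} .{{_ : NonZero n}} (i : Fin n) a → toℕ (i ⊞ a) ≡ (toℕ i + a) % n
toℕ-⊞ i a = Fin.toℕ-fromℕ< _

⊞-identityʳ : ∀ {n} (i : Fin n) → i ⊞ 0 ≡ i
⊞-identityʳ {suc n} i = Fin.toℕ-injective (begin
  toℕ (i ⊞ 0)           ≡⟨ toℕ-⊞ i 0 ⟩
  (toℕ i + 0) % suc n   ≡⟨ cong (_% suc n) (ℕ.+-identityʳ (toℕ i)) ⟩
  toℕ i % suc n         ≡⟨ m<n⇒m%n≡m (Fin.toℕ<n i) ⟩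
  toℕ i                 ∎)
  where open ≡-Reasoning

⊞-assoc : ∀ {n} (i : Fin n) a b → i ⊞ a ⊞ b ≡ i ⊞ (a + b)
⊞-assoc {suc n} i a b = Fin.toℕ-injective (begin
  toℕ (i ⊞ a ⊞ b)                       ≡⟨ toℕ-⊞ (i ⊞ a) b ⟩
  (toℕ (i ⊞ a) + b) % N                 ≡⟨ cong (λ x → (x + b) % N) (toℕ-⊞ i a) ⟩
  ((toℕ i + a) % N + b) % N             ≡⟨ %-distribˡ-+ ((toℕ i + a) % N) b N ⟩
  ((toℕ i + a) % N % N + b % N) % N     ≡⟨ cong (λ x → (x + b % N) % N) (m%n%n≡m%n (toℕ i + a) N) ⟩
  ((toℕ i + a) % N + b % N) % N         ≡⟨ %-distribˡ-+ (toℕ i + a) b N ⟨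
  (toℕ i + a + b) % N                   ≡⟨ cong (_% N) (ℕ.+-assoc (toℕ i) a b) ⟩
  (toℕ i + (a + b)) % N                 ≡⟨ toℕ-⊞ i (a + b) ⟨
  toℕ (i ⊞ (a + b))                     ∎)
  where
  open ≡-Reasoning
  N = suc n

⊞-reaches : ∀ {n} (i j : Fin n) → i ⊞ (n ∸ toℕ i + toℕ j) ≡ j
⊞-reaches {suc n} i j = Fin.toℕ-injective (begin
  toℕ (i ⊞ (N ∸ toℕ i + toℕ j))           ≡⟨ toℕ-⊞ i (N ∸ toℕ i + toℕ j) ⟩
  (toℕ i + (N ∸ toℕ i + toℕ j)) % N       ≡⟨ cong (_% N) (ℕ.+-assoc (toℕ i) (N ∸ toℕ i) (toℕ j)) ⟨
  (toℕ i + (N ∸ toℕ i) + toℕ j) % N       ≡⟨ cong (λ x → (x + toℕ j) % N) (ℕ.m+[n∸m]≡n (ℕ.<⇒≤ (Fin.toℕ<n i))) ⟩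
  (N + toℕ j) % N                         ≡⟨ cong (_% N) (ℕ.+-comm N (toℕ j)) ⟩
  (toℕ j + N) % N                         ≡⟨ [m+n]%n≡m%n (toℕ j) N ⟩
  toℕ j % N                               ≡⟨ m<n⇒m%n≡m (Fin.toℕ<n j) ⟩
  toℕ j                                   ∎)
  where
  open ≡-Reasoning
  N = suc n

⊞-fixedPointFree : ∀ {n} (i : Fin n) a → 0 < a → a < n → i ⊞ a ≢ i
⊞-fixedPointFree {suc n} i a 0<a a<N eq = helper q refl
  where
  open ≡-Reasoning
  N = suc n
  q = (toℕ i + a) / N
  a≡q*N : a ≡ q * N
  a≡q*N = ℕ.+-cancelˡ-≡ (toℕ i) a (q * N) (begin
    toℕ i + a                 ≡⟨ m≡m%n+[m/n]*n (toℕ i + a) N ⟩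
    (toℕ i + a) % N + q * N   ≡⟨ cong (_+ q * N) (trans (sym (toℕ-⊞ i a)) (cong toℕ eq)) ⟩
    toℕ i + q * N             ∎)
  helper : ∀ q′ → q ≡ q′ → ⊥
  helper zero     e = ℕ.<-irrefl (sym (trans a≡q*N (cong (_* N) e))) 0<a
  helper (suc q′) e = ℕ.<⇒≱ a<N
    (subst (N ≤_) (sym (trans a≡q*N (cong (_* N) e))) (ℕ.m≤m+n N (q′ * N)))

CycleAdj : ∀ {n} → Rel (Fin n) 0ℓ
CycleAdj i j = j ≡ i ⊞ 1 ⊎ i ≡ j ⊞ 1

C : (n : ℕ) → 3 ≤ n → Graph
C n 3≤n = record
  { V         = Fin n
  ; order     = n
  ; enumerate = ↔-id (Fin n)
  ; Adj       = CycleAdj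
  ; Adj?      = λ i j → (j Fin.≟ i ⊞ 1) ⊎-dec (i Fin.≟ j ⊞ 1)
  ; symmetric = swap
  ; loopless  = λ { {i} refl (inj₁ eq) → noLoop i (sym eq) ; {i} refl (inj₂ eq) → noLoop i (sym eq) }
  ; connected = λ i j → let a = n ∸ toℕ i + toℕ j in
      a , subst (λ x → Walk CycleAdj i x a) (⊞-reaches i j) (walk i a)
  }
  where
  noLoop : ∀ i → i ⊞ 1 ≢ i
  noLoop i = ⊞-fixedPointFree i 1 (s≤s z≤n) (ℕ.≤-trans (s≤s (s≤s z≤n)) 3≤n)
  walk : ∀ (i : Fin n) a → Walk CycleAdj i (i ⊞ a) a
  walk i zero    = subst (λ x → Walk CycleAdj i x 0) (sym (⊞-identityʳ i)) []
  walk i (suc a) = inj₁ refl ∷ subst (λ x → Walk CycleAdj (i ⊞ 1) x a) (⊞-assoc i 1 a) (walk (i ⊞ 1) a)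

-- A numbering of E(G) by Fin size.  Every edge appears exactly once, with
-- its ends listed in an arbitrary order; sets of edges are then Subset size.
record EdgeEnumeration (G : Graph) : Set where
  field
    size : ℕ
    ends : Fin size → V G × V G

  Joins : Fin size → V G → V G → Set
  Joins e u v = ends e ≡ (u , v) ⊎ ends e ≡ (v , u)

  field
    areEdges : ∀ e → Adj G (proj₁ (ends e)) (proj₂ (ends e))
    covers   : ∀ {u v} → Adj G u v → ∃! _≡_ λ e → Joins e u v

  edge : ∀ {u v} → Adj G u v → Fin size
  edge uv = proj₁ (covers uv)

record Partition (m t : ℕ) : Set where
  field
    class      : Fin t → Subset m
    nonempty   : ∀ j → Nonempty (class j)
    partitions : ∀ e → ∃! _≡_ λ j → e ∈ class j

  classOf : Fin m → Fin t
  classOf e = proj₁ (partitions e)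

sideToParity : Side → Parity
sideToParity inside  = 1ℙ
sideToParity outside = 0ℙ

indicator : ∀ {m} → Subset m → Z₂^ m
indicator = Vec.map sideToParity

module _ {G : Graph} (𝓔 : EdgeEnumeration G) where
  open EdgeEnumeration 𝓔

  -- X is the edge set of a cycle p₀ p₁ ⋯ p₍ₗ₋₁₎ p₀ of G with distinct pᵢ.
  IsCycle : Subset size → Set
  IsCycle X = ∃[ ℓ ] 3 ≤ ℓ × Σ (Fin ℓ → V G) λ p →
    Injective _≡_ _≡_ p ×
    (∀ i → Adj G (p i) (p (i ⊞ 1))) ×
    (∀ e → e ∈ X ⇔ (∃[ i ] Joins e (p i) (p (i ⊞ 1))))

  -- A basis, consisting of cycles, of the cycle space: the subspace of the
  -- edge space spanned by all cycles of G.
  record CycleBasis (c : ℕ) : Set where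
    field
      cycle       : Fin c → Subset size
      isCycle     : ∀ i → IsCycle (cycle i)
      independent : LinearlyIndependent (indicator ∘ cycle)
      spanning    : ∀ X → IsCycle X → indicator X ∈span (indicator ∘ cycle)

  parityMatrix : ∀ {c t} → CycleBasis c → Partition size t → Matrix c t
  parityMatrix B F i = tabulate λ j → parity ∣ class j ∩ cycle i ∣
    where
    open CycleBasis B
    open Partition F

  walkLabel : ∀ {t k} → Partition size t → (Fin t → Z₂^ k) →
              ∀ {u v n} → Walk (Adj G) u v n → Z₂^ k
  walkLabel F g []       = 𝟎
  walkLabel F g (uv ∷ w) = g (Partition.classOf F (edge uv)) ⊕ walkLabel F g w

  -- φ v is the sum of labels along every walk from the root r to v, which
  -- includes independence of the choice of the walk.
  IsLabeling : ∀ {t k} → Partition size t → (Fin t → Z₂^ k) → V G → (V G → Z₂^ k) → Set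
  IsLabeling F g r φ = ∀ {v n} (w : Walk (Adj G) r v n) → φ v ≡ walkLabel F g w

-- An identification of ℤ₂ᵗ / rowspan(A) with ℤ₂ᵏ, given as the quotient
-- homomorphism ℤ₂ᵗ → ℤ₂ᵏ, i.e. a surjection with kernel rowspan(A).
record QuotientByRowspan {c t} (A : Matrix c t) (k : ℕ) : Set where
  field
    π              : Z₂^ t → Z₂^ k
    isHomomorphism : IsGroupHomomorphism
                       (AbelianGroup.rawGroup (Z₂^-abelianGroup t))
                       (AbelianGroup.rawGroup (Z₂^-abelianGroup k)) π
    surjective     : StrictlySurjective _≡_ π
    kernel         : ∀ x → π x ≡ 𝟎 ⇔ x ∈span A

  open IsGroupHomomorphism isHomomorphism using (homo; ε-homo)

  g : Fin t → Z₂^ k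
  g j = π (𝐞 j)

  Label : U.Pred (Z₂^ k) 0ℓ
  Label x = x ≢ 𝟎 × ∃[ j ] g j ≡ x

  private
    gen : ∀ {x} → ⟨ IsUnit ⟩ x → ⟨ Label ⟩ (π x)
    gen ε = subst ⟨ Label ⟩ (sym ε-homo) ε
    gen (_∷_ {g = x} (j , refl) x∈) with g j ≟ᶻ 𝟎
    ... | yes eq = subst ⟨ Label ⟩
                     (sym (trans (homo (𝐞 j) x) (trans (cong (_⊕ π x) eq) (⊕-identityˡ (π x)))))
                     (gen x∈)
    ... | no neq = subst ⟨ Label ⟩ (sym (homo (𝐞 j) x)) ((neq , j , refl) ∷ gen x∈)

  labels : GeneratingSet k
  labels = record
    { S         = Label
    ; S?        = λ x → ¬? (x ≟ᶻ 𝟎) ×-dec Fin.any? λ j → g j ≟ᶻ x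
    ; nonzero   = λ { (𝟎≢𝟎 , _) → 𝟎≢𝟎 refl }
    ; generates = λ x → let y , πy≡x = surjective x in
                        subst ⟨ Label ⟩ πy≡x (gen (units-generate y))
    }

-- For every choice of the identification and of the root, the quotient
-- labeling is a well-defined isometric embedding into ℤ₂ᵏ.
QuotientLabelingRealizes : ∀ {G} (𝓔 : EdgeEnumeration G) {c t}
  (B : CycleBasis 𝓔 c) (F : Partition (EdgeEnumeration.size 𝓔) t) (k : ℕ) → Set
QuotientLabelingRealizes {G} 𝓔 B F k =
  QuotientByRowspan A k ×
  ((π : QuotientByRowspan A k) (r : V G) → let open QuotientByRowspan π in
   Σ (V G → Z₂^ k) λ φ → IsLabeling 𝓔 F g r φ × IsIsometric G (Cay labels) φ)
  where A = parityMatrix 𝓔 B F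

3≤2d : ∀ {d} → 2 ≤ d → 3 ≤ 2 * d
3≤2d 2≤d = ℕ.≤-trans (ℕ.n≤1+n 3) (ℕ.*-monoʳ-≤ 2 2≤d)

evenCycle : (d : ℕ) → 2 ≤ d → Graph
evenCycle d 2≤d = C (2 * d) (3≤2d 2≤d)

-- Edge number a is vₐvₐ₊₁.
cycleEdges : ∀ n (3≤n : 3 ≤ n) → EdgeEnumeration (C n 3≤n)
cycleEdges n 3≤n = record
  { size     = n
  ; ends     = λ a → a , a ⊞ 1
  ; areEdges = λ a → inj₁ refl
  ; covers   = λ
    { {u} {v} (inj₁ refl) → u , inj₁ refl , λ
        { (inj₁ eq) → sym (cong proj₁ eq)
        ; (inj₂ eq) → ⊥-elim (noDouble (cong proj₁ eq) (cong proj₂ eq)) }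
    ; {u} {v} (inj₂ refl) → v , inj₂ refl , λ
        { (inj₁ eq) → ⊥-elim (noDouble (cong proj₁ eq) (cong proj₂ eq))
        ; (inj₂ eq) → sym (cong proj₁ eq) }
    }
  }
  where
  noDouble : ∀ {a u : Fin n} → a ≡ u ⊞ 1 → a ⊞ 1 ≢ u
  noDouble {u = u} refl eq =
    ⊞-fixedPointFree u 2 (s≤s z≤n) 3≤n (trans (sym (⊞-assoc u 1 1)) eq)

evenCycleEdges : (d : ℕ) (2≤d : 2 ≤ d) → EdgeEnumeration (evenCycle d 2≤d)
evenCycleEdges d 2≤d = cycleEdges (2 * d) (3≤2d 2≤d)

-- Every class is an antipodal pair { vₐvₐ₊₁ , vₐ₊d vₐ₊d₊₁ }.
IsAntipodal : ∀ d {t} → Partition (2 * d) t → Set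
IsAntipodal d F = ∀ j → ∃[ a ] Partition.class F j ≡ ⁅ a ⁆ ∪ ⁅ a ⊞ d ⁆

{-# OPTIONS --safe #-}
module Submission where

-- Lower bounds.  The steps of a geodesic in Cay(ℤ₂ᵏ, S) are linearly
-- independent, so Cay(ℤ₂ᵏ, S) has diameter at most k and kmin(G) ≥ diam(G);
-- for the complete graph one only has to count vertices.
-- Even cycles.  The only cycle of C₂d is the whole edge set, which meets every
-- antipodal pair twice, so the parity matrix vanishes and the quotient map is
-- an isomorphism.  An arc of k ≤ d edges meets k distinct classes, so its label
-- has weight k in the transported standard basis, while every step in the
-- Cayley graph changes the weight by at most one.

open import Defs
open import Algebra.Bundles using (AbelianGroup)
open import Algebra.Morphism.Structures using (IsGroupHomomorphism)
import Algebra.Properties.AbelianGroup as AbelianGroupProperties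
import Algebra.Properties.CommutativeSemigroup as CommutativeSemigroupProperties
open import Data.Fin.Base using (Fin; zero; suc; toℕ; fromℕ<; _↑ˡ_)
import Data.Fin.Properties as Fin
open import Data.Fin.Subset using (Subset; _∈_; _∩_; _∪_; ⊤; ⁅_⁆; ∣_∣)
import Data.Fin.Subset.Properties as Subset
open import Data.Nat.Base using (ℕ; zero; suc; _+_; _*_; _∸_; _^_; _≤_; _<_; z≤n; s≤s; parity; NonZero)
open import Data.Nat.DivMod using (_%_; _/_; m≡m%n+[m/n]*n; m<n⇒m%n≡m; [m+n]%n≡m%n)
open import Data.Nat.Logarithm using (⌊log₂_⌋; ⌊log₂[2^n]⌋≡n)
import Data.Nat.Properties as ℕ
open import Data.Parity.Base as ℙ using (0ℙ; 1ℙ)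
import Data.Parity.Properties as ℙ
open import Data.Product.Base using (Σ; ∃-syntax; _×_; _,_; proj₁; proj₂)
open import Data.Sum.Base as Sum using (_⊎_; inj₁; inj₂)
open import Data.Vec.Base using ([]; _∷_; lookup; replicate)
import Data.Vec.Properties as Vec
open import Function.Base using (id; _∘_)
open import Function.Bundles using (_⇔_; mk⇔; Inverse; Equivalence; Injection)
open import Function.Construct.Symmetry using (↔-sym)
open import Function.Definitions using (Injective)
open import Function.Properties.Inverse using (↔⇒↣)
open import Level using (0ℓ)
open import Relation.Binary.Core using (Rel)
open import Relation.Binary.PropositionalEquality
open import Relation.Nullary using (yes; no; contradiction)

-- Vectors over 𝔽₂ and Hamming weight.

module ⊕ {k : ℕ} where
  open AbelianGroupProperties (Z₂^-abelianGroup k) public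
    using (∙-cancelˡ; ∙-cancelʳ)
  open CommutativeSemigroupProperties
    (AbelianGroup.commutativeSemigroup (Z₂^-abelianGroup k)) public
    using (interchange; x∙yz≈y∙xz)

x⊕y≡𝟎⇒x≡y : ∀ {k} (x y : Z₂^ k) → x ⊕ y ≡ 𝟎 → x ≡ y
x⊕y≡𝟎⇒x≡y x y eq = ⊕.∙-cancelʳ y x y (trans eq (sym (⊕-self y)))

weight : ∀ {k} → Z₂^ k → ℕ
weight []       = 0
weight (0ℙ ∷ x) = weight x
weight (1ℙ ∷ x) = suc (weight x)

weight-𝟎 : ∀ k → weight (𝟎 {k}) ≡ 0
weight-𝟎 zero    = refl
weight-𝟎 (suc k) = weight-𝟎 k

weight-𝟏 : ∀ k → weight (replicate k 1ℙ) ≡ k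
weight-𝟏 zero    = refl
weight-𝟏 (suc k) = cong suc (weight-𝟏 k)

weight≤k : ∀ {k} (x : Z₂^ k) → weight x ≤ k
weight≤k []       = z≤n
weight≤k (0ℙ ∷ x) = ℕ.m≤n⇒m≤1+n (weight≤k x)
weight≤k (1ℙ ∷ x) = s≤s (weight≤k x)

k≤weight⇒≡𝟏 : ∀ {k} (x : Z₂^ k) → k ≤ weight x → x ≡ replicate k 1ℙ
k≤weight⇒≡𝟏 []       _   = refl
k≤weight⇒≡𝟏 (0ℙ ∷ x) k<w = contradiction (weight≤k x) (ℕ.<⇒≱ k<w)
k≤weight⇒≡𝟏 (1ℙ ∷ x) k≤w = cong (1ℙ ∷_) (k≤weight⇒≡𝟏 x (ℕ.≤-pred k≤w))

weight-𝐞⊕ : ∀ {k} (i : Fin k) x → weight (𝐞 i ⊕ x) ≤ suc (weight x)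
weight-𝐞⊕ zero    (0ℙ ∷ x) = ℕ.≤-reflexive (cong (suc ∘ weight) (⊕-identityˡ x))
weight-𝐞⊕ zero    (1ℙ ∷ x) = ℕ.≤-trans (ℕ.≤-reflexive (cong weight (⊕-identityˡ x)))
                                       (ℕ.m≤n+m (weight x) 2)
weight-𝐞⊕ (suc i) (0ℙ ∷ x) = weight-𝐞⊕ i x
weight-𝐞⊕ (suc i) (1ℙ ∷ x) = s≤s (weight-𝐞⊕ i x)

weight-𝐞⊕-fresh : ∀ {k} (i : Fin k) x → lookup x i ≡ 0ℙ → weight (𝐞 i ⊕ x) ≡ suc (weight x)
weight-𝐞⊕-fresh zero    (0ℙ ∷ x) _  = cong (suc ∘ weight) (⊕-identityˡ x)
weight-𝐞⊕-fresh (suc i) (0ℙ ∷ x) eq = weight-𝐞⊕-fresh i x eq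
weight-𝐞⊕-fresh (suc i) (1ℙ ∷ x) eq = cong suc (weight-𝐞⊕-fresh i x eq)

lookup-𝐞 : ∀ {k} {i j : Fin k} → i ≢ j → lookup (𝐞 i) j ≡ 0ℙ
lookup-𝐞 {i = zero}  {zero}  i≢j = contradiction refl i≢j
lookup-𝐞 {i = zero}  {suc j} i≢j = Vec.lookup-replicate j 0ℙ
lookup-𝐞 {i = suc i} {zero}  i≢j = refl
lookup-𝐞 {i = suc i} {suc j} i≢j = lookup-𝐞 (i≢j ∘ cong suc)

-- Pigeonhole on `2 ^ m` and `2 ^ n` elements. This replaces dimension theory: linear independence
-- enters the lower bounds only as injectivity of a map.
Z₂^-injection⇒≤ : ∀ {m n} {f : Z₂^ m → Z₂^ n} → Injective _≡_ _≡_ f → m ≤ n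
Z₂^-injection⇒≤ {m} {n} f-injective = ℕ.≮⇒≥ λ n<m →
  ℕ.<⇒≱ (ℕ.^-monoʳ-< 2 (s≤s (s≤s z≤n)) n<m)
    (Fin.injective⇒≤
      (Injection.injective (↔⇒↣ (↔-sym (Z₂^↔Fin m))) ∘ f-injective
        ∘ Injection.injective (↔⇒↣ (Z₂^↔Fin n))))

-- Walks, distances and isometric maps.

mapWalk : ∀ {V W : Set} {_~_ : Rel V 0ℓ} {_≈_ : Rel W 0ℓ} (f : V → W) →
          (∀ {u v} → u ~ v → f u ≈ f v) →
          ∀ {u v n} → Walk _~_ u v n → Walk _≈_ (f u) (f v) n
mapWalk f f-hom []       = []
mapWalk f f-hom (uv ∷ w) = f-hom uv ∷ mapWalk f f-hom w

_∷ʳ_ : ∀ {V : Set} {_~_ : Rel V 0ℓ} {u v w n} → Walk _~_ u v n → v ~ w → Walk _~_ u w (suc n)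
[]       ∷ʳ e = e ∷ []
(e′ ∷ w) ∷ʳ e = e′ ∷ (w ∷ʳ e)

reverseWalk : (G : Graph) → ∀ {u v n} → Walk (Adj G) u v n → Walk (Adj G) v u n
reverseWalk G []      = []
reverseWalk G (e ∷ w) = reverseWalk G w ∷ʳ symmetric G e

Distance-zero : (G : Graph) → ∀ u → Distance G u u 0
Distance-zero G u = [] , λ _ → z≤n

Distance-zero⇒≡ : (G : Graph) → ∀ {u v} → Distance G u v 0 → u ≡ v
Distance-zero⇒≡ G ([] , _) = refl

Distance-sym : (G : Graph) → ∀ {u v n} → Distance G u v n → Distance G v u n
Distance-sym G (w , n≤) = reverseWalk G w , n≤ ∘ reverseWalk G

isometric⇒injective : (G H : Graph) {f : V G → V H} → IsIsometric G H f → Injective _≡_ _≡_ f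
isometric⇒injective G H {f} iso {u} {v} fu≡fv =
  Distance-zero⇒≡ G (Equivalence.from (iso u v 0)
    (subst (λ y → Distance H (f u) y 0) fu≡fv (Distance-zero H (f u))))

-- A walk of `G` no longer than any walk between the images is a geodesic, and so is its image,
-- because `f` carries walks of `G` to walks of `H` of the same length.
hom∧bound⇒isometric : (G H : Graph) (f : V G → V H) →
  (∀ {u v} → Adj G u v → Adj H (f u) (f v)) →
  (∀ u v → ∃[ n ] Walk (Adj G) u v n × (∀ {m} → Walk (Adj H) (f u) (f v) m → n ≤ m)) →
  IsIsometric G H f
hom∧bound⇒isometric G H f hom bound u v n with bound u v
... | n₀ , w₀ , n₀≤ = mk⇔
  (λ (w , n≤) → mapWalk f hom w , λ w′ → ℕ.≤-trans (n≤ w₀) (n₀≤ w′))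
  (λ (w , n≤) → subst (Walk (Adj G) u v) (ℕ.≤-antisym (n₀≤ w) (n≤ (mapWalk f hom w₀))) w₀ ,
                n≤ ∘ mapWalk f hom)

≅⇒isometric : ∀ {G H} (φ : G ≅ H) → IsIsometric G H (_≅_.to φ)
≅⇒isometric {G} {H} φ u v n = mk⇔
  (λ (w , n≤) → forth w , n≤ ∘ back)
  (λ (w , n≤) → back w , n≤ ∘ forth)
  where
  open _≅_ φ
  forth : ∀ {n} → Walk (Adj G) u v n → Walk (Adj H) (to u) (to v) n
  forth = mapWalk to (Equivalence.to (preserves _ _))
  from-hom : ∀ {x y} → Adj H x y → Adj G (from x) (from y)
  from-hom = Equivalence.from (preserves _ _) ∘
    subst₂ (Adj H) (sym (Inverse.strictlyInverseˡ bijection _))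
                   (sym (Inverse.strictlyInverseˡ bijection _))
  back : ∀ {n} → Walk (Adj H) (to u) (to v) n → Walk (Adj G) u v n
  back w = subst₂ (λ x y → Walk (Adj G) x y _)
    (Inverse.strictlyInverseʳ bijection u) (Inverse.strictlyInverseʳ bijection v)
    (mapWalk from from-hom w)

-- Geodesics in Cayley graphs and the diameter bound.

module _ {k : ℕ} {𝓢 : GeneratingSet k} where
  open GeneratingSet 𝓢

  -- The vector `a` selects steps of the walk. As a function of `a` this is the linear map whose
  -- matrix has the steps as its columns.
  subsum : ∀ {x y n} → Walk (CayAdj 𝓢) x y n → Z₂^ n → Z₂^ k
  subsum []                []       = 𝟎
  subsum ((s , _ , _) ∷ w) (0ℙ ∷ a) = subsum w a
  subsum ((s , _ , _) ∷ w) (1ℙ ∷ a) = s ⊕ subsum w a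

  subsum-⊕ : ∀ {x y n} (w : Walk (CayAdj 𝓢) x y n) a b →
             subsum w (a ⊕ b) ≡ subsum w a ⊕ subsum w b
  subsum-⊕ []                []       []       = sym (⊕-identityˡ 𝟎)
  subsum-⊕ (_ ∷ w)           (0ℙ ∷ a) (0ℙ ∷ b) = subsum-⊕ w a b
  subsum-⊕ ((s , _ , _) ∷ w) (0ℙ ∷ a) (1ℙ ∷ b) =
    trans (cong (s ⊕_) (subsum-⊕ w a b)) (⊕.x∙yz≈y∙xz s _ _)
  subsum-⊕ ((s , _ , _) ∷ w) (1ℙ ∷ a) (0ℙ ∷ b) =
    trans (cong (s ⊕_) (subsum-⊕ w a b)) (sym (⊕-assoc s _ _))
  subsum-⊕ ((s , _ , _) ∷ w) (1ℙ ∷ a) (1ℙ ∷ b) = begin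
    subsum w (a ⊕ b)                          ≡⟨ subsum-⊕ w a b ⟩
    subsum w a ⊕ subsum w b                   ≡⟨ ⊕-identityˡ _ ⟨
    𝟎 ⊕ (subsum w a ⊕ subsum w b)             ≡⟨ cong (_⊕ _) (⊕-self s) ⟨
    (s ⊕ s) ⊕ (subsum w a ⊕ subsum w b)       ≡⟨ ⊕.interchange s s _ _ ⟩
    (s ⊕ subsum w a) ⊕ (s ⊕ subsum w b)       ∎
    where open ≡-Reasoning

  subsum-𝟏 : ∀ {x y n} (w : Walk (CayAdj 𝓢) x y n) → x ⊕ subsum w (replicate n 1ℙ) ≡ y
  subsum-𝟏 {x} []                   = ⊕-identityʳ x
  subsum-𝟏 {x} ((s , _ , refl) ∷ w) = trans (sym (⊕-assoc x s _)) (subsum-𝟏 w)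

  -- A generator can be applied at any vertex, so the selected steps still form a walk. The start
  -- `z` is arbitrary because, once a step is left out, the new walk has moved off the old one.
  subwalk : ∀ {x y n} (w : Walk (CayAdj 𝓢) x y n) a z →
            Walk (CayAdj 𝓢) z (z ⊕ subsum w a) (weight a)
  subwalk []                  []       z =
    subst (λ y → Walk (CayAdj 𝓢) z y 0) (sym (⊕-identityʳ z)) []
  subwalk (_ ∷ w)             (0ℙ ∷ a) z = subwalk w a z
  subwalk ((s , s∈S , _) ∷ w) (1ℙ ∷ a) z = (s , s∈S , refl) ∷
    subst (λ y → Walk (CayAdj 𝓢) (z ⊕ s) y (weight a)) (⊕-assoc z s _) (subwalk w a (z ⊕ s))

  -- The steps of a geodesic are linearly independent: steps summing to 𝟎
  -- could be left out.
  geodesic⇒subsum-injective : ∀ {x y n} (geodesic : Distance (Cay 𝓢) x y n) →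
                              Injective _≡_ _≡_ (subsum (proj₁ geodesic))
  geodesic⇒subsum-injective {x} {y} {n} (w , n≤) {a} {b} eq =
    x⊕y≡𝟎⇒x≡y a b (⊕.∙-cancelˡ 𝟏 (a ⊕ b) 𝟎 (trans 𝟏⊕a⊕b≡𝟏 (sym (⊕-identityʳ 𝟏))))
    where
    open ≡-Reasoning
    𝟏 = replicate n 1ℙ
    -- `𝟏 ⊕ (a ⊕ b)` keeps the steps on which `a` and `b` agree; the others sum to 𝟎 by `eq`, so
    -- leaving them out does not move the end.
    same-end : x ⊕ subsum w (𝟏 ⊕ (a ⊕ b)) ≡ y
    same-end = begin
      x ⊕ subsum w (𝟏 ⊕ (a ⊕ b))                     ≡⟨ cong (x ⊕_) (subsum-⊕ w 𝟏 _) ⟩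
      x ⊕ (subsum w 𝟏 ⊕ subsum w (a ⊕ b))            ≡⟨ cong (λ z → x ⊕ (subsum w 𝟏 ⊕ z)) (subsum-⊕ w a b) ⟩
      x ⊕ (subsum w 𝟏 ⊕ (subsum w a ⊕ subsum w b))   ≡⟨ cong (λ z → x ⊕ (subsum w 𝟏 ⊕ (z ⊕ subsum w b))) eq ⟩
      x ⊕ (subsum w 𝟏 ⊕ (subsum w b ⊕ subsum w b))   ≡⟨ cong (λ z → x ⊕ (subsum w 𝟏 ⊕ z)) (⊕-self (subsum w b)) ⟩
      x ⊕ (subsum w 𝟏 ⊕ 𝟎)                           ≡⟨ cong (x ⊕_) (⊕-identityʳ _) ⟩
      x ⊕ subsum w 𝟏                                 ≡⟨ subsum-𝟏 w ⟩
      y                                              ∎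
    𝟏⊕a⊕b≡𝟏 : 𝟏 ⊕ (a ⊕ b) ≡ 𝟏
    -- The remaining walk has length `weight (𝟏 ⊕ (a ⊕ b))`, which minimality forces to be at least
    -- `n`; hence no step was left out.
    𝟏⊕a⊕b≡𝟏 = k≤weight⇒≡𝟏 _ (n≤
      (subst (λ z → Walk (CayAdj 𝓢) x z _) same-end (subwalk w (𝟏 ⊕ (a ⊕ b)) x)))

-- A diametral pair keeps its distance `d` in the Cayley graph, and a geodesic there injects ℤ₂ᵈ
-- into ℤ₂ᵏ.
diameter≤dimension : ∀ G {d k} → HasDiameter G d → EmbedsInDimension G k → d ≤ k
diameter≤dimension G (_ , u , v , dist) (𝓢 , f , iso) =
  Z₂^-injection⇒≤ (geodesic⇒subsum-injective {𝓢 = 𝓢} (Equivalence.to (iso u v _) dist))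

-- Hypercubes.

Q-lift : ∀ {t} p {x y : Z₂^ t} {n} →
         Walk (Adj (Q t)) x y n → Walk (Adj (Q (suc t))) (p ∷ x) (p ∷ y) n
Q-lift p = mapWalk (p ∷_) λ { (_ , (i , refl) , refl) →
  𝐞 (suc i) , (suc i , refl) , cong (_∷ _) (sym (ℙ.+-identityʳ p)) }

Q-walk : ∀ {t} (x y : Z₂^ t) → Walk (Adj (Q t)) x (x ⊕ y) (weight y)
Q-walk []      []       = []
Q-walk (p ∷ x) (0ℙ ∷ y) = subst (λ q → Walk _ (p ∷ x) (q ∷ x ⊕ y) _)
  (sym (ℙ.+-identityʳ p)) (Q-lift p (Q-walk x y))
Q-walk (p ∷ x) (1ℙ ∷ y) = (𝐞 zero , (zero , refl) , cong (_ ∷_) (sym (⊕-identityʳ x))) ∷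
  Q-lift (p ℙ.+ 1ℙ) (Q-walk x y)

weight-≤-Q-walk : ∀ {t} {x y : Z₂^ t} {n} → Walk (Adj (Q t)) x y n → weight (x ⊕ y) ≤ n
weight-≤-Q-walk {t} {x} []                       =
  ℕ.≤-reflexive (trans (cong weight (⊕-self x)) (weight-𝟎 t))
weight-≤-Q-walk {x = x} {y} {suc n} (_∷_ (_ , (i , refl) , refl) w) = begin
  -- The first step `𝐞 i` is inserted twice: one copy moves `x` to the second vertex of the walk,
  -- the other costs at most one unit of weight.
  weight (x ⊕ y)                  ≡⟨ cong weight (⊕-cancel (𝐞 i) (x ⊕ y)) ⟨
  weight (𝐞 i ⊕ (𝐞 i ⊕ (x ⊕ y)))  ≡⟨ cong (λ z → weight (𝐞 i ⊕ z)) (⊕-assoc (𝐞 i) x y) ⟨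
  weight (𝐞 i ⊕ (𝐞 i ⊕ x ⊕ y))    ≡⟨ cong (λ z → weight (𝐞 i ⊕ (z ⊕ y))) (⊕-comm (𝐞 i) x) ⟩
  weight (𝐞 i ⊕ (x ⊕ 𝐞 i ⊕ y))    ≤⟨ weight-𝐞⊕ i _ ⟩
  suc (weight (x ⊕ 𝐞 i ⊕ y))      ≤⟨ s≤s (weight-≤-Q-walk w) ⟩
  suc n                           ∎
  where open ℕ.≤-Reasoning

Q-distance : ∀ {t} (x y : Z₂^ t) → Distance (Q t) x y (weight (x ⊕ y))
Q-distance x y =
  subst (λ z → Walk _ x z (weight (x ⊕ y))) (⊕-cancel x y) (Q-walk x (x ⊕ y)) , weight-≤-Q-walk

Q-diameter : ∀ t → HasDiameter (Q t) t
Q-diameter t =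
  (λ x y → weight (x ⊕ y) , Q-distance x y , weight≤k (x ⊕ y)) ,
  𝟎 , replicate t 1ℙ ,
  subst (Distance (Q t) _ _)
    (trans (cong weight (⊕-identityˡ (replicate t 1ℙ))) (weight-𝟏 t))
    (Q-distance 𝟎 (replicate t 1ℙ))

Q-kmin : ∀ t → IsKmin (Q t) t
Q-kmin t = (units t , id , λ _ _ _ → mk⇔ id id) , λ j → diameter≤dimension (Q t) (Q-diameter t)

-- Complete graphs.

K-distance-one : ∀ {n} {u v : Fin n} → u ≢ v → Distance (K n) u v 1
K-distance-one {n} {u} {v} u≢v = (u≢v ∷ []) , at-least-one
  where
  at-least-one : ∀ {m} → Walk _≢_ u v m → 1 ≤ m
  at-least-one []      = contradiction refl u≢v
  at-least-one (_ ∷ _) = s≤s z≤n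

K-diameter : ∀ {n} → 2 ≤ n → HasDiameter (K n) 1
K-diameter {n@(suc (suc _))} (s≤s (s≤s _)) = bounded , zero , suc zero , K-distance-one λ ()
  where
  bounded : ∀ u v → ∃[ m ] Distance (K n) u v m × m ≤ 1
  bounded u v with u Fin.≟ v
  ... | yes refl = 0 , Distance-zero (K n) u , z≤n
  ... | no u≢v   = 1 , K-distance-one u≢v , s≤s z≤n

-- The only possible generator between two labels is their sum, which is nonzero exactly when the
-- labels differ, so any bijection of the vertex sets would serve.
K≅Cay : ∀ t → K (2 ^ t) ≅ Cay (allNonzero t)
K≅Cay t = record
  { bijection = ↔-sym (Z₂^↔Fin t)
  ; preserves = λ u v → mk⇔
      (λ u≢v → to u ⊕ to v , u≢v ∘ injective ∘ x⊕y≡𝟎⇒x≡y _ _ , sym (⊕-cancel (to u) (to v)))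
      (λ { (s , s≢𝟎 , eq) refl → s≢𝟎 (⊕.∙-cancelˡ (to u) s 𝟎 (trans (sym eq) (sym (⊕-identityʳ _)))) })
  }
  where open Injection (↔⇒↣ (↔-sym (Z₂^↔Fin t))) using (to; injective)

K-kmin : ∀ t → IsKmin (K (2 ^ t)) t
K-kmin t = (allNonzero t , _≅_.to (K≅Cay t) , ≅⇒isometric (K≅Cay t)) ,
  λ j (𝓢 , f , iso) → Z₂^-injection⇒≤
    (Injection.injective (↔⇒↣ (Z₂^↔Fin t)) ∘ isometric⇒injective (K (2 ^ t)) (Cay 𝓢) iso)

-- Rotations of the vertices modulo `n`.

module _ {n : ℕ} (i : Fin n) where
  private instance _ = Fin.nonZeroIndex i

  ⊞-period : i ⊞ n ≡ i
  ⊞-period = Fin.toℕ-injective (begin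
    toℕ (i ⊞ n)     ≡⟨ toℕ-⊞ i n ⟩
    (toℕ i + n) % n ≡⟨ [m+n]%n≡m%n (toℕ i) n ⟩
    toℕ i % n       ≡⟨ m<n⇒m%n≡m (Fin.toℕ<n i) ⟩
    toℕ i           ∎)
    where open ≡-Reasoning

  ⊞-difference : ∀ j → toℕ i ≤ toℕ j → i ⊞ (toℕ j ∸ toℕ i) ≡ j
  ⊞-difference j i≤j = Fin.toℕ-injective (begin
    toℕ (i ⊞ (toℕ j ∸ toℕ i))     ≡⟨ toℕ-⊞ i _ ⟩
    (toℕ i + (toℕ j ∸ toℕ i)) % n ≡⟨ cong (_% n) (ℕ.m+[n∸m]≡n i≤j) ⟩
    toℕ j % n                     ≡⟨ m<n⇒m%n≡m (Fin.toℕ<n j) ⟩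
    toℕ j                         ∎)
    where open ≡-Reasoning

  -- Completing the turn undoes a shift; this stands in for subtraction in `⊞-cancelʳ`.
  ⊞-return : ∀ {a} → a ≤ n → i ⊞ a ⊞ (n ∸ a) ≡ i
  ⊞-return {a} a≤n =
    trans (⊞-assoc i a (n ∸ a)) (trans (cong (i ⊞_) (ℕ.m+[n∸m]≡n a≤n)) ⊞-period)

⊞-comm : ∀ {n} (i : Fin n) a b → i ⊞ a ⊞ b ≡ i ⊞ b ⊞ a
⊞-comm i a b =
  trans (⊞-assoc i a b) (trans (cong (i ⊞_) (ℕ.+-comm a b)) (sym (⊞-assoc i b a)))

⊞-cancelʳ : ∀ {n} {i j : Fin n} {a} → a ≤ n → i ⊞ a ≡ j ⊞ a → i ≡ j
⊞-cancelʳ {n} {i} {j} {a} a≤n eq =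
  trans (sym (⊞-return i a≤n)) (trans (cong (_⊞ (n ∸ a)) eq) (⊞-return j a≤n))

-- Two-element sets and matrices with zero rows.

∣⁅i⁆∪⁅j⁆∣≡2 : ∀ {n} {i j : Fin n} → i ≢ j → ∣ ⁅ i ⁆ ∪ ⁅ j ⁆ ∣ ≡ 2
∣⁅i⁆∪⁅j⁆∣≡2 {i = zero}  {zero}  i≢j = contradiction refl i≢j
∣⁅i⁆∪⁅j⁆∣≡2 {i = zero}  {suc j} i≢j =
  cong suc (trans (cong ∣_∣ (Subset.∪-identityˡ ⁅ j ⁆)) (Subset.∣⁅x⁆∣≡1 j))
∣⁅i⁆∪⁅j⁆∣≡2 {i = suc i} {zero}  i≢j =
  cong suc (trans (cong ∣_∣ (Subset.∪-identityʳ ⁅ i ⁆)) (Subset.∣⁅x⁆∣≡1 i))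
∣⁅i⁆∪⁅j⁆∣≡2 {i = suc i} {suc j} i≢j = ∣⁅i⁆∪⁅j⁆∣≡2 (i≢j ∘ cong suc)

·-zeroʳ : ∀ {k} p → p · 𝟎 {k} ≡ 𝟎
·-zeroʳ {k} p = trans (Vec.map-replicate (p ℙ.*_) 0ℙ k) (cong (replicate k) (ℙ.*-zeroʳ p))

·-identityˡ : ∀ {k} (x : Z₂^ k) → 1ℙ · x ≡ x
·-identityˡ = Vec.map-id

lincomb-zeroʳ : ∀ {k c} a {v : Fin c → Z₂^ k} → (∀ i → v i ≡ 𝟎) → lincomb a v ≡ 𝟎
lincomb-zeroʳ {c = zero}  a v≡𝟎 = refl
lincomb-zeroʳ {c = suc c} a v≡𝟎 = trans
  (cong₂ _⊕_ (trans (cong (a zero ·_) (v≡𝟎 zero)) (·-zeroʳ (a zero)))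
             (lincomb-zeroʳ (a ∘ suc) (v≡𝟎 ∘ suc)))
  (⊕-identityˡ 𝟎)

∈span-zero : ∀ {k c} {v : Fin c → Z₂^ k} → (∀ i → v i ≡ 𝟎) → ∀ x → x ∈span v ⇔ x ≡ 𝟎
∈span-zero v≡𝟎 x = mk⇔
  (λ (a , eq) → trans (sym eq) (lincomb-zeroʳ a v≡𝟎))
  (λ x≡𝟎 → (λ _ → 0ℙ) , trans (lincomb-zeroʳ (λ _ → 0ℙ) v≡𝟎) (sym x≡𝟎))

-- The empty family is a basis of the row space, since both spans consist of 𝟎 alone.
rank-zero : ∀ {c t} {A : Matrix c t} → (∀ i → A i ≡ 𝟎) → HasRank A 0
rank-zero {t = t} A≡𝟎 = none , (λ _ _ ()) , λ x → mk⇔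
  (Equivalence.from (∈span-zero A≡𝟎 x) ∘ Equivalence.to (∈span-zero {v = none} (λ ()) x))
  (Equivalence.from (∈span-zero {v = none} (λ ()) x) ∘ Equivalence.to (∈span-zero A≡𝟎 x))
  where
  none : Fin 0 → Z₂^ t
  none ()

identityQuotient : ∀ {c t} {A : Matrix c t} → (∀ i → A i ≡ 𝟎) → QuotientByRowspan A t
identityQuotient A≡𝟎 = record
  { π              = id
  ; isHomomorphism = record
    { isMonoidHomomorphism = record
      { isMagmaHomomorphism = record
        { isRelHomomorphism = record { cong = id }
        ; homo = λ _ _ → refl
        }
      ; ε-homo = refl
      }
    ; ⁻¹-homo = λ _ → refl
    }
  ; surjective     = λ x → x , refl
  ; kernel         = λ x → mk⇔ (Equivalence.from (∈span-zero A≡𝟎 x)) (Equivalence.to (∈span-zero A≡𝟎 x))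
  }

-- The cycle space of a cycle graph.

module _ {n : ℕ} (3≤n : 3 ≤ n) where
  private
    G = C n 3≤n
    𝓔 = cycleEdges n 3≤n

  C-walk : ∀ (i : Fin n) a → Walk (Adj G) i (i ⊞ a) a
  C-walk i zero    = subst (λ x → Walk CycleAdj i x 0) (sym (⊞-identityʳ i)) []
  C-walk i (suc a) = inj₁ refl ∷
    subst (λ x → Walk CycleAdj (i ⊞ 1) x a) (⊞-assoc i 1 a) (C-walk (i ⊞ 1) a)

  ⊤-isCycle : IsCycle 𝓔 ⊤
  ⊤-isCycle = n , 3≤n , id , id , (λ _ → inj₁ refl) ,
    λ e → mk⇔ (λ _ → e , inj₁ refl) (λ _ → Subset.∈⊤)

  -- A cycle cannot turn back, so after the edge e it runs (or before it has
  -- run, when oriented the other way) through the edge e ⊞ 1.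
  isCycle⇒≡⊤ : ∀ {X} → IsCycle 𝓔 X → X ≡ ⊤
  isCycle⇒≡⊤ {X} (ℓ@(suc ℓ-1) , 3≤ℓ , p , p-injective , p-adj , X⇔) =
    Subset.⊆-antisym Subset.⊆⊤ λ {e} _ →
      subst (_∈ X) (⊞-reaches first e) (closed-⊞ _)
    where
    open EdgeEnumeration 𝓔

    1≤n : 1 ≤ n
    1≤n = ℕ.≤-trans (s≤s z≤n) 3≤n

    no-turn : ∀ i → p i ≢ p (i ⊞ 1 ⊞ 1)
    no-turn i eq = ⊞-fixedPointFree i 2 (s≤s z≤n) 3≤ℓ
      (trans (sym (⊞-assoc i 1 1)) (sym (p-injective eq)))

    -- Adding `ℓ-1` modulo `ℓ` moves one index back.
    predecessor : ∀ i → i ⊞ ℓ-1 ⊞ 1 ≡ i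
    predecessor i =
      trans (⊞-assoc i ℓ-1 1) (trans (cong (i ⊞_) (ℕ.+-comm ℓ-1 1)) (⊞-period i))

    -- If `p` ascends from index `i`, it must ascend again at the next step, and that step traverses
    -- the edge numbered `p i ⊞ 1`.
    forward : ∀ i → p (i ⊞ 1) ≡ p i ⊞ 1 → p i ⊞ 1 ∈ X
    forward i eq with p-adj (i ⊞ 1)
    ... | inj₁ next = Equivalence.from (X⇔ _)
      (i ⊞ 1 , inj₁ (cong₂ _,_ (sym eq) (trans (cong (_⊞ 1) (sym eq)) (sym next))))
    ... | inj₂ next = contradiction (⊞-cancelʳ 1≤n (trans (sym eq) next)) (no-turn i)

    -- If `p` descends after index `j ⊞ 1`, it already descended into it, along the edge numbered
    -- `p (j ⊞ 1)`.
    backward : ∀ j → p (j ⊞ 1) ≡ p (j ⊞ 1 ⊞ 1) ⊞ 1 → p (j ⊞ 1) ∈ X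
    backward j eq with p-adj j
    ... | inj₁ next = contradiction (⊞-cancelʳ 1≤n (trans (sym next) eq)) (no-turn j)
    ... | inj₂ next = Equivalence.from (X⇔ _) (j , inj₂ (cong₂ _,_ refl (sym next)))

    closed : ∀ {e} → e ∈ X → e ⊞ 1 ∈ X
    closed {e} e∈X with Equivalence.to (X⇔ e) e∈X
    ... | i , inj₁ eq = subst (_∈ X) (cong (_⊞ 1) (sym (cong proj₁ eq)))
      (forward i (trans (sym (cong proj₂ eq)) (cong (_⊞ 1) (cong proj₁ eq))))
    ... | i , inj₂ eq = subst (_∈ X) (sym e⊞1≡)
      (backward (i ⊞ ℓ-1) (trans (sym e⊞1≡)
        (cong (_⊞ 1) (trans (cong proj₁ eq) (cong (λ k → p (k ⊞ 1)) (sym (predecessor i)))))))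
      where
      e⊞1≡ : e ⊞ 1 ≡ p (i ⊞ ℓ-1 ⊞ 1)
      e⊞1≡ = trans (cong proj₂ eq) (cong p (sym (predecessor i)))

    first : Fin n
    first = edge (p-adj zero)

    closed-⊞ : ∀ a → first ⊞ a ∈ X
    closed-⊞ zero    = subst (_∈ X) (sym (⊞-identityʳ first))
      (Equivalence.from (X⇔ first) (zero , proj₁ (proj₂ (covers (p-adj zero)))))
    closed-⊞ (suc a) = subst (_∈ X) (trans (⊞-assoc first a 1) (cong (first ⊞_) (ℕ.+-comm a 1)))
      (closed (closed-⊞ a))

C-cycleBasis : ∀ {n} (3≤n : 3 ≤ n) → CycleBasis (cycleEdges n 3≤n) 1
C-cycleBasis {suc _} 3≤n = record
  { cycle       = λ _ → ⊤
  ; isCycle     = λ _ → ⊤-isCycle 3≤n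
  -- All entries of the indicator of `⊤` are `1ℙ`, so the first coordinate of the combination is the
  -- coefficient. Matching `n` as a successor makes that coordinate available.
  ; independent = λ { a eq zero →
      trans (sym (trans (ℙ.+-identityʳ _) (ℙ.*-identityʳ (a zero)))) (Vec.∷-injectiveˡ eq) }
  ; spanning    = λ X X-isCycle → (λ _ → 1ℙ) ,
      trans (⊕-identityʳ _) (trans (·-identityˡ _) (cong indicator (sym (isCycle⇒≡⊤ 3≤n X-isCycle))))
  }

-- Short arcs in even cycles.

⊞-antipode² : ∀ d (i : Fin (2 * d)) → i ⊞ d ⊞ d ≡ i
⊞-antipode² d i =
  -- `2 * d` unfolds to `d + (d + 0)`, hence the appeal to `ℕ.+-identityʳ` here and later.
  trans (⊞-assoc i d d) (trans (cong (λ a → i ⊞ (d + a)) (sym (ℕ.+-identityʳ d))) (⊞-period i))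

module EvenCycle {d : ℕ} (2≤d : 2 ≤ d) where

  0<d : 0 < d
  0<d = ℕ.≤-trans (s≤s z≤n) 2≤d

  d<2d : d < 2 * d
  d<2d = ℕ.m<m+n d (ℕ.≤-trans 0<d (ℕ.m≤m+n d 0))

  G : Graph
  G = evenCycle d 2≤d

  𝓔 : EdgeEnumeration G
  𝓔 = evenCycleEdges d 2≤d

  short-arc-≤ : ∀ (u v : Fin (2 * d)) → toℕ u ≤ toℕ v →
                ∃[ k ] k ≤ d × (v ≡ u ⊞ k ⊎ u ≡ v ⊞ k)
  short-arc-≤ u v u≤v with ℕ.≤-total (toℕ v ∸ toℕ u) d
  ... | inj₁ a≤d = toℕ v ∸ toℕ u , a≤d , inj₁ (sym (⊞-difference u v u≤v))
  -- The complementary arc has length `2 * d ∸ a` and runs forward from `v` to `u`.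
  ... | inj₂ d≤a = 2 * d ∸ a , 2d∸a≤d ,
    inj₂ (trans (sym (⊞-return u a≤2d)) (cong (_⊞ (2 * d ∸ a)) (⊞-difference u v u≤v)))
    where
    a = toℕ v ∸ toℕ u
    a≤2d : a ≤ 2 * d
    a≤2d = ℕ.≤-trans (ℕ.m∸n≤m (toℕ v) (toℕ u)) (ℕ.<⇒≤ (Fin.toℕ<n v))
    2d∸a≤d : 2 * d ∸ a ≤ d
    2d∸a≤d = ℕ.≤-trans (ℕ.∸-monoʳ-≤ (2 * d) d≤a)
      (ℕ.≤-reflexive (trans (ℕ.m+n∸m≡n d (d + 0)) (ℕ.+-identityʳ d)))

  short-arc : ∀ (u v : Fin (2 * d)) → ∃[ k ] k ≤ d × (v ≡ u ⊞ k ⊎ u ≡ v ⊞ k)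
  short-arc u v with ℕ.≤-total (toℕ u) (toℕ v)
  ... | inj₁ u≤v = short-arc-≤ u v u≤v
  ... | inj₂ v≤u = let k , k≤d , eqs = short-arc-≤ v u v≤u in k , k≤d , Sum.swap eqs

  -- Partitions into antipodal pairs and the class vectors of arcs.

  module Antipodal {t : ℕ} (F : Partition (2 * d) t) (antipodal : IsAntipodal d F) where
    open Partition F

    classOf-∈ : ∀ e → e ∈ class (classOf e)
    classOf-∈ e = proj₁ (proj₂ (partitions e))

    ∈⇒classOf≡ : ∀ {e j} → e ∈ class j → classOf e ≡ j
    ∈⇒classOf≡ {e} = proj₂ (proj₂ (partitions e))

    representative : Fin t → Fin (2 * d)
    representative j = proj₁ (antipodal j)

    class-⁺ : ∀ {e} j → e ≡ representative j ⊎ e ≡ representative j ⊞ d → e ∈ class j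
    class-⁺ {e} j e≡ = subst (e ∈_) (sym (proj₂ (antipodal j)))
      (Subset.x∈p∪q⁺ (Sum.map (Equivalence.from Subset.x∈⁅y⁆⇔x≡y) (Equivalence.from Subset.x∈⁅y⁆⇔x≡y) e≡))

    class-⁻ : ∀ {e} j → e ∈ class j → e ≡ representative j ⊎ e ≡ representative j ⊞ d
    class-⁻ {e} j e∈ = Sum.map (Subset.x∈⁅y⁆⇒x≡y _) (Subset.x∈⁅y⁆⇒x≡y _)
      (Subset.x∈p∪q⁻ _ _ (subst (e ∈_) (proj₂ (antipodal j)) e∈))

    classOf-representative : ∀ j → classOf (representative j) ≡ j
    classOf-representative j = ∈⇒classOf≡ (class-⁺ j (inj₁ refl))

    classOf-⊞d : ∀ e → classOf (e ⊞ d) ≡ classOf e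
    classOf-⊞d e = ∈⇒classOf≡ (class-⁺ (classOf e) (Sum.swap (Sum.map
      (cong (_⊞ d)) (λ eq → trans (cong (_⊞ d) eq) (⊞-antipode² d _))
      (class-⁻ (classOf e) (classOf-∈ e)))))

    classOf≡⇒ : ∀ {e e′} → classOf e ≡ classOf e′ → e ≡ e′ ⊎ e ≡ e′ ⊞ d
    classOf≡⇒ {e} {e′} eq
      with class-⁻ (classOf e′) (subst (λ j → e ∈ class j) eq (classOf-∈ e))
         | class-⁻ (classOf e′) (classOf-∈ e′)
    ... | inj₁ p | inj₁ q = inj₁ (trans p (sym q))
    ... | inj₁ p | inj₂ q = inj₂ (trans p (sym (trans (cong (_⊞ d) q) (⊞-antipode² d _))))
    ... | inj₂ p | inj₁ q = inj₂ (trans p (cong (_⊞ d) (sym q)))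
    ... | inj₂ p | inj₂ q = inj₁ (trans p (sym q))

    ∣class∣≡2 : ∀ j → ∣ class j ∣ ≡ 2
    ∣class∣≡2 j = trans (cong ∣_∣ (proj₂ (antipodal j)))
      (∣⁅i⁆∪⁅j⁆∣≡2 (≢-sym (⊞-fixedPointFree (representative j) d 0<d d<2d)))

    parityMatrix-zero : ∀ {c} (B : CycleBasis 𝓔 c) i → parityMatrix 𝓔 B F i ≡ 𝟎
    parityMatrix-zero B i = trans
      (Vec.tabulate-cong λ j → trans (cong parity (even j)) (sym (Vec.lookup-replicate j 0ℙ)))
      (Vec.tabulate∘lookup 𝟎)
      where
      open CycleBasis B
      even : ∀ j → ∣ class j ∩ cycle i ∣ ≡ 2
      even j = trans
        (cong ∣_∣ (trans (cong (class j ∩_) (isCycle⇒≡⊤ (3≤2d 2≤d) (isCycle i))) (Subset.∩-identityʳ (class j))))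
        (∣class∣≡2 j)

    -- The label, before passing to the quotient, of the walk making `m` forward steps from `u`; it
    -- may wind around the cycle several times.
    arc : Fin (2 * d) → ℕ → Z₂^ t
    arc u zero    = 𝟎
    arc u (suc m) = 𝐞 (classOf u) ⊕ arc (u ⊞ 1) m

    arc-+ : ∀ u a b → arc u (a + b) ≡ arc u a ⊕ arc (u ⊞ a) b
    arc-+ u zero    b = trans (cong (λ x → arc x b) (sym (⊞-identityʳ u))) (sym (⊕-identityˡ _))
    arc-+ u (suc a) b = begin
      𝐞 (classOf u) ⊕ arc (u ⊞ 1) (a + b)                    ≡⟨ cong (_ ⊕_) (arc-+ (u ⊞ 1) a b) ⟩
      𝐞 (classOf u) ⊕ (arc (u ⊞ 1) a ⊕ arc (u ⊞ 1 ⊞ a) b)    ≡⟨ ⊕-assoc _ _ _ ⟨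
      𝐞 (classOf u) ⊕ arc (u ⊞ 1) a ⊕ arc (u ⊞ 1 ⊞ a) b      ≡⟨ cong (λ x → arc u (suc a) ⊕ arc x b) (⊞-assoc u 1 a) ⟩
      𝐞 (classOf u) ⊕ arc (u ⊞ 1) a ⊕ arc (u ⊞ suc a) b      ∎
      where open ≡-Reasoning

    arc-antipode : ∀ u m → arc (u ⊞ d) m ≡ arc u m
    arc-antipode u zero    = refl
    arc-antipode u (suc m) = cong₂ _⊕_ (cong 𝐞 (classOf-⊞d u))
      (trans (cong (λ x → arc x m) (⊞-comm u d 1)) (arc-antipode (u ⊞ 1) m))

    -- The second half turn meets the same classes as the first, so everything cancels. This is what
    -- makes labels independent of the walk.
    arc-full : ∀ u → arc u (2 * d) ≡ 𝟎
    arc-full u = begin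
      arc u (d + (d + 0))              ≡⟨ arc-+ u d (d + 0) ⟩
      arc u d ⊕ arc (u ⊞ d) (d + 0)    ≡⟨ cong (arc u d ⊕_) (arc-antipode u (d + 0)) ⟩
      arc u d ⊕ arc u (d + 0)          ≡⟨ cong (λ m → arc u d ⊕ arc u m) (ℕ.+-identityʳ d) ⟩
      arc u d ⊕ arc u d                ≡⟨ ⊕-self (arc u d) ⟩
      𝟎                                ∎
      where open ≡-Reasoning

    arc-multiple : ∀ u q m → arc u (q * (2 * d) + m) ≡ arc u m
    arc-multiple u zero    m = refl
    arc-multiple u (suc q) m = begin
      arc u (2 * d + q * (2 * d) + m)                      ≡⟨ cong (arc u) (ℕ.+-assoc (2 * d) _ m) ⟩
      arc u (2 * d + (q * (2 * d) + m))                    ≡⟨ arc-+ u (2 * d) _ ⟩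
      arc u (2 * d) ⊕ arc (u ⊞ 2 * d) (q * (2 * d) + m)    ≡⟨ cong₂ _⊕_ (arc-full u) (cong (λ x → arc x (q * (2 * d) + m)) (⊞-period u)) ⟩
      𝟎 ⊕ arc u (q * (2 * d) + m)                          ≡⟨ ⊕-identityˡ _ ⟩
      arc u (q * (2 * d) + m)                              ≡⟨ arc-multiple u q m ⟩
      arc u m                                              ∎
      where open ≡-Reasoning

    arc-% : ∀ u m .{{_ : NonZero (2 * d)}} → arc u (m % (2 * d)) ≡ arc u m
    arc-% u m = trans (sym (arc-multiple u (m / (2 * d)) _))
      (cong (arc u) (trans (ℕ.+-comm (m / (2 * d) * (2 * d)) _) (sym (m≡m%n+[m/n]*n m (2 * d)))))

    lookup-arc : ∀ u m {j} → (∀ i → i < m → classOf (u ⊞ i) ≢ j) → lookup (arc u m) j ≡ 0ℙ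
    lookup-arc u zero    {j} _     = Vec.lookup-replicate j 0ℙ
    lookup-arc u (suc m) {j} avoid = trans (Vec.lookup-zipWith ℙ._+_ j (𝐞 (classOf u)) (arc (u ⊞ 1) m))
      (cong₂ ℙ._+_
        (lookup-𝐞 (avoid 0 (s≤s z≤n) ∘ trans (cong classOf (⊞-identityʳ u))))
        (lookup-arc (u ⊞ 1) m λ i i<m → avoid (suc i) (s≤s i<m) ∘ trans (cong classOf (sym (⊞-assoc u 1 i)))))

    classOf-⊞≢ : ∀ u a → 0 < a → a < d → classOf (u ⊞ a) ≢ classOf u
    classOf-⊞≢ u a 0<a a<d eq with classOf≡⇒ eq
    ... | inj₁ u⊞a≡u   = ⊞-fixedPointFree u a 0<a (ℕ.<-trans a<d d<2d) u⊞a≡u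
    -- A further shift by `d ∸ a`, which is positive and less than `2 * d`, would fix `u ⊞ a`.
    ... | inj₂ u⊞a≡u⊞d = ⊞-fixedPointFree (u ⊞ a) (d ∸ a) (ℕ.m<n⇒0<n∸m a<d)
      (ℕ.≤-<-trans (ℕ.m∸n≤m d a) d<2d)
      (trans (⊞-assoc u a (d ∸ a)) (trans (cong (u ⊞_) (ℕ.m+[n∸m]≡n (ℕ.<⇒≤ a<d))) (sym u⊞a≡u⊞d)))

    -- Within `d` consecutive edges the class of the first does not recur, so its coordinate is
    -- still zero and prepending it raises the weight by exactly one.
    weight-arc : ∀ u {k} → k ≤ d → weight (arc u k) ≡ k
    weight-arc u {zero}  _   = weight-𝟎 t
    weight-arc u {suc k} k<d = trans
      (weight-𝐞⊕-fresh (classOf u) (arc (u ⊞ 1) k) (lookup-arc (u ⊞ 1) k λ i i<k →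
        classOf-⊞≢ u (suc i) (s≤s z≤n) (ℕ.≤-<-trans i<k k<d) ∘ trans (cong classOf (sym (⊞-assoc u 1 i)))))
      (cong suc (weight-arc (u ⊞ 1) (ℕ.<⇒≤ k<d)))

    -- The quotient labeling, for an arbitrary identification and root.

    module Labeling {c : ℕ} {A : Matrix c t} (A≡𝟎 : ∀ i → A i ≡ 𝟎)
                    (quotient : QuotientByRowspan A t) (r : Fin (2 * d)) where
      open QuotientByRowspan quotient
      open IsGroupHomomorphism isHomomorphism using (homo; ε-homo)

      π-injective : Injective _≡_ _≡_ π
      π-injective {x} {y} πx≡πy = x⊕y≡𝟎⇒x≡y x y (Equivalence.to (∈span-zero A≡𝟎 (x ⊕ y))
        (Equivalence.to (kernel (x ⊕ y))
          (trans (homo x y) (trans (cong (_⊕ π y) πx≡πy) (⊕-self (π y))))))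

      -- The length is the number of forward steps by which `⊞-reaches` leads from `r` to `v`. At
      -- the root it is a full turn and not 0.
      ψ : Fin (2 * d) → Z₂^ t
      ψ v = arc r (2 * d ∸ toℕ r + toℕ v)

      ψ-root : ψ r ≡ 𝟎
      ψ-root = trans (cong (arc r) (ℕ.m∸n+n≡m (ℕ.<⇒≤ (Fin.toℕ<n r)))) (arc-full r)

      ψ-step : ∀ v → ψ (v ⊞ 1) ≡ ψ v ⊕ 𝐞 (classOf v)
      ψ-step v = begin
        arc r (a + toℕ (v ⊞ 1))                     ≡⟨ cong (λ m → arc r (a + m)) (toℕ-⊞ v 1) ⟩
        arc r (a + (toℕ v + 1) % (2 * d))           ≡⟨ arc-+ r a _ ⟩
        -- If `v` is the last vertex, `v ⊞ 1` wraps to 0 and the length drops by a full turn, whose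
        -- label is 𝟎.
        arc r a ⊕ arc _ ((toℕ v + 1) % (2 * d))     ≡⟨ cong (arc r a ⊕_) (arc-% _ (toℕ v + 1)) ⟩
        arc r a ⊕ arc _ (toℕ v + 1)                 ≡⟨ arc-+ r a _ ⟨
        arc r (a + (toℕ v + 1))                     ≡⟨ cong (arc r) (ℕ.+-assoc a (toℕ v) 1) ⟨
        arc r (a + toℕ v + 1)                       ≡⟨ arc-+ r (a + toℕ v) 1 ⟩
        ψ v ⊕ arc (r ⊞ (a + toℕ v)) 1               ≡⟨ cong (λ x → ψ v ⊕ arc x 1) (⊞-reaches r v) ⟩
        ψ v ⊕ (𝐞 (classOf v) ⊕ 𝟎)                   ≡⟨ cong (ψ v ⊕_) (⊕-identityʳ _) ⟩
        ψ v ⊕ 𝐞 (classOf v)                         ∎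
        where
        open ≡-Reasoning
        instance _ = Fin.nonZeroIndex r
        a = 2 * d ∸ toℕ r

      φ : Fin (2 * d) → Z₂^ t
      φ v = π (ψ v)

      φ-step : ∀ v → φ (v ⊞ 1) ≡ φ v ⊕ g (classOf v)
      φ-step v = trans (cong π (ψ-step v)) (homo _ _)

      φ-walk : ∀ {u v n} (w : Walk (Adj G) u v n) → φ v ≡ φ u ⊕ walkLabel 𝓔 F g w
      φ-walk {u} []              = sym (⊕-identityʳ (φ u))
      φ-walk {u} (inj₁ refl ∷ w) =
        trans (φ-walk w) (trans (cong (_⊕ walkLabel 𝓔 F g w) (φ-step u)) (⊕-assoc _ _ _))
      -- A backward step from `v ⊞ 1` to `v` uses edge `v`; its label is its own inverse, so adding
      -- it twice reverses `φ-step`.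
      φ-walk {u} (_∷_ {v = v} (inj₂ refl) w) = begin
        φ _                                                      ≡⟨ φ-walk w ⟩
        φ v ⊕ walkLabel 𝓔 F g w                                  ≡⟨ cong (_⊕ walkLabel 𝓔 F g w) (⊕-cancelʳ (φ v) (g (classOf v))) ⟨
        φ v ⊕ g (classOf v) ⊕ g (classOf v) ⊕ walkLabel 𝓔 F g w  ≡⟨ cong (λ x → x ⊕ g (classOf v) ⊕ walkLabel 𝓔 F g w) (φ-step v) ⟨
        φ (v ⊞ 1) ⊕ g (classOf v) ⊕ walkLabel 𝓔 F g w            ≡⟨ ⊕-assoc _ _ _ ⟩
        φ (v ⊞ 1) ⊕ (g (classOf v) ⊕ walkLabel 𝓔 F g w)          ∎
        where open ≡-Reasoning

      φ-isLabeling : IsLabeling 𝓔 F g r φ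
      φ-isLabeling w = trans (φ-walk w)
        (trans (cong (_⊕ walkLabel 𝓔 F g w) (trans (cong π ψ-root) ε-homo)) (⊕-identityˡ _))

      φ-hom : ∀ {u v} → Adj G u v → Adj (Cay labels) (φ u) (φ v)
      φ-hom (inj₁ refl) = step _
        where
        step : ∀ v → Adj (Cay labels) (φ v) (φ (v ⊞ 1))
        step v = g (classOf v) ,
          ((λ eq → 𝐞≢𝟎 (classOf v) (π-injective (trans eq (sym ε-homo)))) , classOf v , refl) , φ-step v
      φ-hom {v = v} (inj₂ refl) = symmetric (Cay labels) (φ-hom {v} (inj₁ refl))

      -- Every generator is the image of a standard basis vector, so the displacement lifts through
      -- `π`, and each step adds at most one to the weight of the lift.
      labels-walk : ∀ {x y m} → Walk (Adj (Cay labels)) x y m → ∃[ z ] y ≡ x ⊕ π z × weight z ≤ m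
      labels-walk {x} [] =
        𝟎 , sym (trans (cong (x ⊕_) ε-homo) (⊕-identityʳ x)) , ℕ.≤-reflexive (weight-𝟎 t)
      labels-walk {x} ((_ , (_ , j , refl) , refl) ∷ w) =
        let z , y≡ , z≤ = labels-walk w in
        𝐞 j ⊕ z ,
        trans y≡ (trans (⊕-assoc x _ _) (cong (x ⊕_) (sym (homo (𝐞 j) z)))) ,
        ℕ.≤-trans (weight-𝐞⊕ j z) (s≤s z≤)

      φ-arc : ∀ u k → φ (u ⊞ k) ≡ φ u ⊕ π (arc u k)
      φ-arc u zero    = trans (cong φ (⊞-identityʳ u)) (sym (trans (cong (φ u ⊕_) ε-homo) (⊕-identityʳ _)))
      φ-arc u (suc k) = begin
        φ (u ⊞ suc k)                                 ≡⟨ cong φ (⊞-assoc u 1 k) ⟨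
        φ (u ⊞ 1 ⊞ k)                                 ≡⟨ φ-arc (u ⊞ 1) k ⟩
        φ (u ⊞ 1) ⊕ π (arc (u ⊞ 1) k)                 ≡⟨ cong (_⊕ _) (φ-step u) ⟩
        φ u ⊕ g (classOf u) ⊕ π (arc (u ⊞ 1) k)       ≡⟨ ⊕-assoc _ _ _ ⟩
        φ u ⊕ (g (classOf u) ⊕ π (arc (u ⊞ 1) k))     ≡⟨ cong (φ u ⊕_) (homo _ _) ⟨
        φ u ⊕ π (arc u (suc k))                       ∎
        where open ≡-Reasoning

      -- By injectivity of `π` the lift of the displacement can only be `arc u k`, whose weight is
      -- `k`.
      arc-bound : ∀ u {k m} → k ≤ d → Walk (Adj (Cay labels)) (φ u) (φ (u ⊞ k)) m → k ≤ m
      arc-bound u {k} {m} k≤d w = let z , eq , z≤m = labels-walk w in begin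
        k                  ≡⟨ weight-arc u k≤d ⟨
        weight (arc u k)   ≡⟨ cong weight (π-injective (⊕.∙-cancelˡ (φ u) _ _ (trans (sym (φ-arc u k)) eq))) ⟩
        weight z           ≤⟨ z≤m ⟩
        m                  ∎
        where open ℕ.≤-Reasoning

      φ-isometric : IsIsometric G (Cay labels) φ
      φ-isometric = hom∧bound⇒isometric G (Cay labels) φ φ-hom bound
        where
        bound : ∀ u v → ∃[ n ] Walk (Adj G) u v n × (∀ {m} → Walk (Adj (Cay labels)) (φ u) (φ v) m → n ≤ m)
        bound u v with short-arc u v
        ... | k , k≤d , inj₁ refl = k , C-walk (3≤2d 2≤d) u k , arc-bound u k≤d
        ... | k , k≤d , inj₂ refl = k , reverseWalk G (C-walk (3≤2d 2≤d) v k) ,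
          arc-bound v k≤d ∘ reverseWalk (Cay labels)

      -- Distances in the cycle are read off from the embedding: `φ` would carry a shorter walk to
      -- one violating `arc-bound`.
      arc-distance : ∀ u {k} → k ≤ d → Distance G u (u ⊞ k) k
      arc-distance u k≤d = C-walk (3≤2d 2≤d) u _ , arc-bound u k≤d ∘ mapWalk φ φ-hom

    realizes : ∀ {c} (B : CycleBasis 𝓔 c) → QuotientLabelingRealizes 𝓔 B F t
    realizes B = identityQuotient (parityMatrix-zero B) , λ quotient r →
      let open Labeling (parityMatrix-zero B) quotient r in φ , φ-isLabeling , φ-isometric

  -- Existence of the antipodal partition and its number of classes.

  classes-≤ : ∀ {t t′} (F : Partition (2 * d) t) (F′ : Partition (2 * d) t′) →
              IsAntipodal d F → IsAntipodal d F′ → t ≤ t′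
  -- A class of `F` goes to the `F′`-class of its representative. Edges sharing a class of `F′` are
  -- equal or antipodal, hence share a class of `F`.
  classes-≤ F F′ anti anti′ = Fin.injective⇒≤ {f = Partition.classOf F′ ∘ A.representative} injective
    where
    module A = Antipodal F anti
    module A′ = Antipodal F′ anti′
    injective : Injective _≡_ _≡_ (Partition.classOf F′ ∘ A.representative)
    injective {i} {j} eq = trans (sym (A.classOf-representative i))
      (trans (same (A′.classOf≡⇒ eq)) (A.classOf-representative j))
      where
      same : ∀ {e e′} → e ≡ e′ ⊎ e ≡ e′ ⊞ d → Partition.classOf F e ≡ Partition.classOf F e′
      same (inj₁ eq) = cong (Partition.classOf F) eq
      same (inj₂ eq) = trans (cong (Partition.classOf F) eq) (A.classOf-⊞d _)

  low : Fin d → Fin (2 * d)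
  low j = j ↑ˡ (d + 0)

  toℕ-antipode : ∀ (j : Fin d) → toℕ (low j ⊞ d) ≡ toℕ j + d
  toℕ-antipode j = begin
    toℕ (low j ⊞ d)              ≡⟨ toℕ-⊞ (low j) d ⟩
    (toℕ (low j) + d) % (2 * d)  ≡⟨ cong (λ a → (a + d) % (2 * d)) (Fin.toℕ-↑ˡ j _) ⟩
    (toℕ j + d) % (2 * d)        ≡⟨ m<n⇒m%n≡m j+d<2d ⟩
    toℕ j + d                    ∎
    where
    open ≡-Reasoning
    instance _ = Fin.nonZeroIndex (low j)
    j+d<2d : toℕ j + d < 2 * d
    j+d<2d = ℕ.<-≤-trans (ℕ.+-monoˡ-< d (Fin.toℕ<n j)) (ℕ.+-monoʳ-≤ d (ℕ.m≤m+n d 0))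

  pair : Fin d → Subset (2 * d)
  pair j = ⁅ low j ⁆ ∪ ⁅ low j ⊞ d ⁆

  pair⇔ : ∀ {e} j → e ∈ pair j ⇔ (toℕ e ≡ toℕ j ⊎ toℕ e ≡ toℕ j + d)
  pair⇔ j = mk⇔
    (λ e∈ → Sum.map
      (λ e∈ → trans (cong toℕ (Subset.x∈⁅y⁆⇒x≡y _ e∈)) (Fin.toℕ-↑ˡ j (d + 0)))
      (λ e∈ → trans (cong toℕ (Subset.x∈⁅y⁆⇒x≡y _ e∈)) (toℕ-antipode j))
      (Subset.x∈p∪q⁻ _ _ e∈))
    (λ eq → Subset.x∈p∪q⁺ (Sum.map
      (λ eq → Equivalence.from Subset.x∈⁅y⁆⇔x≡y (Fin.toℕ-injective (trans eq (sym (Fin.toℕ-↑ˡ j (d + 0))))))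
      (λ eq → Equivalence.from Subset.x∈⁅y⁆⇔x≡y (Fin.toℕ-injective (trans eq (sym (toℕ-antipode j)))))
      eq))

  -- In the mixed cases an index below `d` would be at least `d`.
  pair-unique : ∀ {m} (i j : Fin d) → (m ≡ toℕ i ⊎ m ≡ toℕ i + d) → (m ≡ toℕ j ⊎ m ≡ toℕ j + d) → i ≡ j
  pair-unique i j (inj₁ refl) (inj₁ eq) = Fin.toℕ-injective eq
  pair-unique i j (inj₁ refl) (inj₂ eq) =
    contradiction (subst (d ≤_) (sym eq) (ℕ.m≤n+m d (toℕ j))) (ℕ.<⇒≱ (Fin.toℕ<n i))
  pair-unique i j (inj₂ refl) (inj₁ eq) =
    contradiction (subst (d ≤_) eq (ℕ.m≤n+m d (toℕ i))) (ℕ.<⇒≱ (Fin.toℕ<n j))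
  pair-unique i j (inj₂ refl) (inj₂ eq) = Fin.toℕ-injective (ℕ.+-cancelʳ-≡ d _ _ eq)

  pair-exists : ∀ {m} → m < 2 * d → ∃[ j ] (m ≡ toℕ {d} j ⊎ m ≡ toℕ j + d)
  pair-exists {m} m<2d with m ℕ.<? d
  ... | yes m<d = fromℕ< m<d , inj₁ (sym (Fin.toℕ-fromℕ< m<d))
  ... | no m≮d  = fromℕ< m∸d<d ,
    inj₂ (sym (trans (cong (_+ d) (Fin.toℕ-fromℕ< m∸d<d)) (ℕ.m∸n+n≡m (ℕ.≮⇒≥ m≮d))))
    where
    m∸d<d : m ∸ d < d
    m∸d<d = ℕ.<-≤-trans (ℕ.∸-monoˡ-< m<2d (ℕ.≮⇒≥ m≮d))
      (ℕ.≤-reflexive (trans (ℕ.m+n∸m≡n d (d + 0)) (ℕ.+-identityʳ d)))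

  antipodalPairs : Partition (2 * d) d
  antipodalPairs = record
    { class      = pair
    ; nonempty   = λ j → low j , Subset.x∈p∪q⁺ (inj₁ (Subset.x∈⁅x⁆ _))
    ; partitions = λ e → let j , e≡ = pair-exists (Fin.toℕ<n e) in
        j , Equivalence.from (pair⇔ j) e≡ , λ {i} e∈ → pair-unique j i e≡ (Equivalence.to (pair⇔ i) e∈)
    }

  antipodalPairs-isAntipodal : IsAntipodal d antipodalPairs
  antipodalPairs-isAntipodal j = low j , refl

  antipodal⇒t≡d : ∀ {t} (F : Partition (2 * d) t) → IsAntipodal d F → t ≡ d
  antipodal⇒t≡d F anti = ℕ.≤-antisym
    (classes-≤ F antipodalPairs anti antipodalPairs-isAntipodal)
    (classes-≤ antipodalPairs F antipodalPairs-isAntipodal anti)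

  -- Diameter and least dimension of even cycles.

  private
    root : Fin (2 * d)
    root = fromℕ< (ℕ.<-trans 0<d d<2d)

    -- One concrete labeling, with the identity as quotient map and root 0, yields both the diameter
    -- and the upper bound on the dimension.
    module Pairs = Antipodal antipodalPairs antipodalPairs-isAntipodal

    zeros = Pairs.parityMatrix-zero (C-cycleBasis (3≤2d 2≤d))

    module L = Pairs.Labeling zeros (identityQuotient zeros) root

  C-diameter : HasDiameter G d
  C-diameter = bounded , root , root ⊞ d , L.arc-distance root ℕ.≤-refl
    where
    bounded : ∀ u v → ∃[ n ] Distance G u v n × n ≤ d
    bounded u v with short-arc u v
    ... | k , k≤d , inj₁ refl = k , L.arc-distance u k≤d , k≤d
    ... | k , k≤d , inj₂ refl = k , Distance-sym G (L.arc-distance v k≤d) , k≤d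

  C-kmin : IsKmin G d
  C-kmin = (QuotientByRowspan.labels (identityQuotient zeros) , L.φ , L.φ-isometric) ,
    λ j → diameter≤dimension G C-diameter

proposition2p36 : (∀ t →
    IsKmin (Q t) t × HasDiameter (Q t) t ×
    order (Q t) ≡ 2 ^ t × ⌊log₂ order (Q t) ⌋ ≡ t)
    ×
    (∀ t → 1 ≤ t →
    HasDiameter (K (2 ^ t)) 1 × IsKmin (K (2 ^ t)) t ×
    Σ (K (2 ^ t) ≅ Cay (allNonzero t)) λ φ →
    IsIsometric (K (2 ^ t)) (Cay (allNonzero t)) (_≅_.to φ))
    ×
    (∀ d (2≤d : 2 ≤ d) →
    IsKmin (evenCycle d 2≤d) d × HasDiameter (evenCycle d 2≤d) d ×
    (∃[ c ] CycleBasis (evenCycleEdges d 2≤d) c) ×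
    (∃[ t ] Σ (Partition (2 * d) t) (IsAntipodal d)) ×
    (∀ {c t} (B : CycleBasis (evenCycleEdges d 2≤d) c) (F : Partition (2 * d) t) →
    IsAntipodal d F →
    t ≡ d ×
    (∃[ ρ ] HasRank (parityMatrix (evenCycleEdges d 2≤d) B F) ρ × ρ ≡ 0 × t ∸ ρ ≡ d ×
    QuotientLabelingRealizes (evenCycleEdges d 2≤d) B F (t ∸ ρ))))
proposition2p36 =
  (λ t → Q-kmin t , Q-diameter t , refl , ⌊log₂[2^n]⌋≡n t) ,
  (λ t 1≤t → K-diameter (ℕ.^-monoʳ-≤ 2 1≤t) , K-kmin t , K≅Cay t , ≅⇒isometric (K≅Cay t)) ,
  λ d 2≤d → let open EvenCycle 2≤d in
    C-kmin , C-diameter ,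
    (1 , C-cycleBasis (3≤2d 2≤d)) ,
    (d , antipodalPairs , antipodalPairs-isAntipodal) ,
    λ B F antipodal →
      antipodal⇒t≡d F antipodal ,
      -- With rank 0, `t ∸ ρ` reduces to `t`, so the equation `t ≡ d` and the realization in
      -- dimension `t` apply as they stand.
      0 , rank-zero (Antipodal.parityMatrix-zero F antipodal B) , refl ,
      antipodal⇒t≡d F antipodal , Antipodal.realizes F antipodal B
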